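{- There exist infinitely many (pairwise non-isomorphic) tetravalent graphs of girth $5$ admitting a half-arc-transitive group of automorphisms such that each edge of the graph lies on a unique $5$-cycle, and there also exist infinitely many tetravalent graphs of girth $5$ admitting a half-arc-transitive group of automorphisms such that each edge of the graph lies on precisely two $5$-cycles.
   Context: Graphs are finite, simple, connected. A subgroup $G\le\mathrm{Aut}(\Gamma)$ is half-arc-transitive on $\Gamma$ if it is transitive on vertices and on edges but not on arcs (ordered pairs of adjacent vertices). -}

module Defs where

open import Level using (0ℓ)
open import Data.Nat using (ℕ; zero; suc; _≤_; _<_)
open import Data.Fin using (Fin; zero; suc; inject₁; fromℕ)
open import Data.Fin.Permutation using (Permutation; Permutation′; _⟨$⟩ʳ_; id; flip; _∘ₚ_)
open import Data.Bool using (Bool; true; false)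
open import Data.Product using (Σ; ∃; _×_; _,_)
open import Data.Sum using (_⊎_)
open import Data.Empty using (⊥)
open import Relation.Nullary using (¬_)
open import Relation.Binary.PropositionalEquality using (_≡_; _≢_)

record Graph : Set where
  field
    n      : ℕ
    adj    : Fin n → Fin n → Bool
    irrefl : ∀ x → adj x x ≡ false
    sym    : ∀ x y → adj x y ≡ adj y x

module _ (Γ : Graph) where
  open Graph Γ

  V : Set
  V = Fin n

  Adj : V → V → Set
  Adj x y = adj x y ≡ true

  data Reach : V → V → Set where
    here : ∀ {u} → Reach u u
    step : ∀ {u w v} → Adj u w → Reach w v → Reach u v

  Connected : Set
  Connected = ∀ u v → Reach u v

  Tetravalent : Set
  Tetravalent = ∀ x → Σ (Fin 4 → V) λ g →
      (∀ i j → g i ≡ g j → i ≡ j)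
    × (∀ i → Adj x (g i))
    × (∀ y → Adj x y → ∃ λ i → g i ≡ y)

  IsCycle : (m : ℕ) → (Fin (suc m) → V) → Set
  IsCycle m f =
      (∀ i j → f i ≡ f j → i ≡ j)
    × (∀ (i : Fin m) → Adj (f (inject₁ i)) (f (suc i)))
    × Adj (f (fromℕ m)) (f zero)

  HasCycle : ℕ → Set
  HasCycle zero    = ⊥
  HasCycle (suc m) = Σ (Fin (suc m) → V) (IsCycle m)

  Girth : ℕ → Set
  Girth g = HasCycle g × (∀ ℓ → 3 ≤ ℓ → ℓ < g → ¬ HasCycle ℓ)

  -- 5-cycles through the edge {u,v}, listed as the (unique) traversal
  -- starting at u and proceeding to v
  FiveCycleThrough : V → V → (Fin 5 → V) → Set
  FiveCycleThrough u v f = IsCycle 4 f × f zero ≡ u × f (suc zero) ≡ v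

  _≗_ : (Fin 5 → V) → (Fin 5 → V) → Set
  f ≗ g = ∀ i → f i ≡ g i

  EachEdgeOnUnique5Cycle : Set
  EachEdgeOnUnique5Cycle = ∀ u v → Adj u v →
    Σ (Fin 5 → V) λ f → FiveCycleThrough u v f
      × (∀ h → FiveCycleThrough u v h → h ≗ f)

  EachEdgeOnExactlyTwo5Cycles : Set
  EachEdgeOnExactlyTwo5Cycles = ∀ u v → Adj u v →
    Σ (Fin 5 → V) λ f → Σ (Fin 5 → V) λ g →
        FiveCycleThrough u v f × FiveCycleThrough u v g × ¬ (f ≗ g)
      × (∀ h → FiveCycleThrough u v h → h ≗ f ⊎ h ≗ g)

  IsAut : Permutation′ n → Set
  IsAut σ = ∀ x y → adj (σ ⟨$⟩ʳ x) (σ ⟨$⟩ʳ y) ≡ adj x y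

  IsSubgroupOfAut : (Permutation′ n → Set) → Set
  IsSubgroupOfAut G =
      (∀ σ → G σ → IsAut σ)
    × G id
    × (∀ σ τ → G σ → G τ → G (σ ∘ₚ τ))
    × (∀ σ → G σ → G (flip σ))

  VertexTransitive : (Permutation′ n → Set) → Set
  VertexTransitive G = ∀ u v → Σ (Permutation′ n) λ σ → G σ × σ ⟨$⟩ʳ u ≡ v

  EdgeTransitive : (Permutation′ n → Set) → Set
  EdgeTransitive G = ∀ u v x y → Adj u v → Adj x y →
    Σ (Permutation′ n) λ σ → G σ ×
      ((σ ⟨$⟩ʳ u ≡ x × σ ⟨$⟩ʳ v ≡ y) ⊎ (σ ⟨$⟩ʳ u ≡ y × σ ⟨$⟩ʳ v ≡ x))

  ArcTransitive : (Permutation′ n → Set) → Set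
  ArcTransitive G = ∀ u v x y → Adj u v → Adj x y →
    Σ (Permutation′ n) λ σ → G σ × σ ⟨$⟩ʳ u ≡ x × σ ⟨$⟩ʳ v ≡ y

  HalfArcTransitive : (Permutation′ n → Set) → Set
  HalfArcTransitive G = IsSubgroupOfAut G × VertexTransitive G
    × EdgeTransitive G × ¬ ArcTransitive G

  AdmitsHATGroup : Set₁
  AdmitsHATGroup = Σ (Permutation′ n → Set) HalfArcTransitive

Isomorphic : Graph → Graph → Set
Isomorphic Γ Δ = Σ (Permutation (Graph.n Γ) (Graph.n Δ)) λ φ →
  ∀ x y → Graph.adj Δ (φ ⟨$⟩ʳ x) (φ ⟨$⟩ʳ y) ≡ Graph.adj Γ x y

InfinitelyManyNonIso : (Graph → Set₁) → Set₁
InfinitelyManyNonIso P = Σ (ℕ → Graph) λ F →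
  (∀ i j → i ≢ j → ¬ Isomorphic (F i) (F j)) × (∀ i → P (F i))

{-# OPTIONS --safe #-}
module Submission where

-- Both families consist of shift registers.  A vertex is a level i ∈ ℤ/5, a word
-- of L bits (L = 4 for one 5-cycle per edge, L = 3 for two) and five counters in
-- ℤ/m; an arc raises the level, drops the first bit of the word and appends a new
-- one.  Levels exclude triangles and force 5-cycles to be directed closed walks
-- of length 5.  On words alone such a walk is a cyclic binary sequence of length 5,
-- an arc shows L + 1 of its entries, so it lies on 2^(4 - L) of them.  The only
-- 4-cycles there are the alternating ones (two arcs out of each of two vertices into
-- the same two vertices), in which a dropped bit y and an appended bit y′ vary
-- independently; a counter increased by y·y′ detects them.  The same counter is
-- decreased by y·y′ two levels later, so closed walks of length 5 still close.
--
-- For L = 3 this is the skeleton of a finite quotient of the tiling {5,4} by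
-- right-angled pentagons, the bit flips being reflections.  Flipping the bit y
-- turns y·y′ into y′ - y·y′, hence it lifts to an automorphism that negates the
-- counter and corrects it by ±y′ at some levels.  Flips, translations of the
-- counters and the rotation of the levels act transitively on the arcs of this
-- orientation, so the group of all orientation-preserving automorphisms of the
-- underlying graph is half-arc-transitive.

open import Defs
open import Data.Bool using (Bool; true; false; not; _∧_; _∨_)
open import Data.Bool.Properties using (∨-comm; ∨-zeroʳ; not-involutive)
open import Data.Fin using (Fin; zero; suc; toℕ; inject₁; opposite)
open import Data.Fin.Induction using (<-weakInduction)
open import Data.Fin.Patterns using (0F; 1F; 2F; 3F; 4F)
open import Data.Fin.Permutation using (Permutation′; _⟨$⟩ʳ_; inverseʳ; ↔⇒≡)
open import Data.Fin.Properties using (_≟_; all?; *↔×; 2↔Bool; opposite-involutive; toℕ-inject₁)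
open import Data.Nat using (ℕ; suc; 2+; _+_; _*_; _<_; _≤_; s≤s)
import Data.Nat.Properties as ℕ
open import Data.Product using (Σ; ∃; _×_; _,_; proj₁; proj₂)
open import Data.Product.Function.NonDependent.Propositional using (_×-↔_)
open import Data.Sum as Sum using (_⊎_; inj₁; inj₂)
open import Function using (_∘_; _↔_; Inverse; mk⇔; mk↔ₛ′)
open import Function.Construct.Composition using (_↔-∘_)
open import Function.Construct.Identity using (↔-id)
open import Function.Construct.Symmetry using (↔-sym)
open import Relation.Binary.Construct.Closure.Equivalence using (EqClosure; symmetric)
open import Relation.Binary.Construct.Closure.ReflexiveTransitive using (ε; _◅_; _◅◅_)
open import Relation.Binary.Construct.Closure.Symmetric using (fwd; bwd)
open import Relation.Binary.Definitions using (tri<; tri≈; tri>)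
open import Relation.Binary.PropositionalEquality using (_≡_; _≢_; refl; sym; trans; cong; cong₂; subst; subst₂)
open import Relation.Nullary using (¬_; Dec; does; proof; Reflects; invert; contradiction)
open import Relation.Nullary.Decidable using (from-yes; map′; dec-true; dec-false; does-⇔; _→-dec_; _×-dec_; ¬?)

-- Walks on the cycle of five levels.

next prev : Fin 5 → Fin 5
next 0F = 1F
next 1F = 2F
next 2F = 3F
next 3F = 4F
next 4F = 0F
prev 0F = 4F
prev 1F = 0F
prev 2F = 1F
prev 3F = 2F
prev 4F = 3F

prev-next : ∀ i → prev (next i) ≡ i
prev-next = from-yes (all? λ i → prev (next i) ≟ i)

next-prev : ∀ i → next (prev i) ≡ i
next-prev = from-yes (all? λ i → next (prev i) ≟ i)

next≢id : ∀ i → next i ≢ i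
next≢id = from-yes (all? λ i → ¬? (next i ≟ i))

next²≢id : ∀ i → next (next i) ≢ i
next²≢id = from-yes (all? λ i → ¬? (next (next i) ≟ i))

next≢prev : ∀ i → next i ≢ prev i
next≢prev = from-yes (all? λ i → ¬? (next i ≟ prev i))

-- Directions of traversal: 0F follows an arc, 1F goes against it.
shift : Fin 2 → Fin 5 → Fin 5
shift 0F = next
shift 1F = prev

shift³≢id : ∀ r s t i → shift t (shift s (shift r i)) ≢ i
shift³≢id = from-yes (all? λ r → all? λ s → all? λ t → all? λ i →
  ¬? (shift t (shift s (shift r i)) ≟ i))

-- With k steps against the arcs the level changes by 4 - 2k, which 5 divides only for k = 2.
shift⁴-balanced : ∀ r s t u i → shift u (shift t (shift s (shift r i))) ≡ i →
  toℕ r + toℕ s + toℕ t + toℕ u ≡ 2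
shift⁴-balanced = from-yes (all? λ r → all? λ s → all? λ t → all? λ u → all? λ i →
  (shift u (shift t (shift s (shift r i))) ≟ i) →-dec
  (toℕ r + toℕ s + toℕ t + toℕ u ℕ.≟ 2))

-- With k steps against the arcs the level changes by 5 - 2k, an odd number between -5 and 5, so a
-- closed walk has k = 0 or k = 5.
shift⁵-constant : ∀ r s t u v i → shift v (shift u (shift t (shift s (shift r i)))) ≡ i →
  r ≡ s × s ≡ t × t ≡ u × u ≡ v
shift⁵-constant = from-yes (all? λ r → all? λ s → all? λ t → all? λ u → all? λ v → all? λ i →
  (shift v (shift u (shift t (shift s (shift r i)))) ≟ i) →-dec
  ((r ≟ s) ×-dec (s ≟ t) ×-dec (t ≟ u) ×-dec (u ≟ v)))

offset : Fin 5 → Fin 5 → Fin 5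
offset 0F i = i
offset 1F i = next i
offset 2F i = next (next i)
offset 3F i = next (next (next i))
offset 4F i = next (next (next (next i)))

offset-injective : ∀ i j k → offset j i ≡ offset k i → j ≡ k
offset-injective = from-yes (all? λ i → all? λ j → all? λ k →
  (offset j i ≟ offset k i) →-dec (j ≟ k))

-- Digraphs over the cycle of levels.

-- The digraph on Fin 5 × State with arcs (i , x) ⟶ (next i , push d x).
record LevelledDigraph : Set₁ where
  field
    State           : Set
    states          : ℕ
    stateCode       : State ↔ Fin states
    push pull       : Bool → State → State
    newest oldest   : State → Bool
    newest-push     : ∀ d x → newest (push d x) ≡ d
    oldest-pull     : ∀ d x → oldest (pull d x) ≡ d
    pull-push       : ∀ d x → pull (oldest x) (push d x) ≡ x
    push-pull       : ∀ d x → push (newest x) (pull d x) ≡ x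
    -- This excludes the 4-cycles that alternate in direction; the next field excludes those made of
    -- two directed paths of length 2.
    push-injective  : ∀ x y → push false x ≡ push false y → push true x ≡ push true y → x ≡ y
    push²-injective : ∀ d d′ e x → push e (push d x) ≡ push e (push d′ x) → d ≡ d′

  Vertex : Set
  Vertex = Fin 5 × State

  size : ℕ
  size = 5 * states

  opaque
    code : Vertex ↔ Fin size
    code = ↔-sym *↔× ↔-∘ (↔-id (Fin 5) ×-↔ stateCode)

  level : Vertex → Fin 5
  level = proj₁

  up down : Bool → Vertex → Vertex
  up d (i , x) = next i , push d x
  down d (i , x) = prev i , pull d x

  gained lost : Vertex → Bool
  gained (_ , x) = newest x
  lost (_ , x) = oldest x

  Arc : Vertex → Vertex → Set
  Arc v w = ∃ λ d → up d v ≡ w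

  up-arc : ∀ d v → Arc v (up d v)
  up-arc d v = d , refl

  down-arc : ∀ d v → Arc (down d v) v
  down-arc d (i , x) = newest x , cong₂ _,_ (next-prev i) (push-pull d x)

  gained-arc : ∀ {v w} → Arc v w → up (gained w) v ≡ w
  gained-arc {v} (d , refl) = cong (λ e → up e v) (newest-push d (proj₂ v))

  lost-arc : ∀ {v w} → Arc v w → down (lost v) w ≡ v
  lost-arc {i , x} (d , refl) = cong₂ _,_ (prev-next i) (pull-push d x)

  level-arc : ∀ {v w} → Arc v w → level w ≡ next (level v)
  level-arc (d , refl) = refl

  Linked : Vertex → Vertex → Set
  Linked = EqClosure Arc

  -- Orbits of automorphisms on arcs.

  Automorphism : Set
  Automorphism = Σ (Vertex ↔ Vertex) λ φ →
      (∀ {v w} → Arc v w → Arc (Inverse.to φ v) (Inverse.to φ w))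
    × (∀ {v w} → Arc v w → Arc (Inverse.from φ v) (Inverse.from φ w))

  infix 4 _∼_
  -- The pair `(v , d)` stands for the arc from `v` to `up d v`; related pairs are arcs in the same
  -- orbit.
  _∼_ : Vertex × Bool → Vertex × Bool → Set
  (v , d) ∼ (w , e) = Σ Automorphism λ (φ , _) →
    Inverse.to φ v ≡ w × Inverse.to φ (up d v) ≡ up e w

  ∼-refl : ∀ {x} → x ∼ x
  ∼-refl = (↔-id _ , (λ a → a) , (λ a → a)) , refl , refl

  ∼-sym : ∀ {x y} → x ∼ y → y ∼ x
  ∼-sym ((φ , to-arc , from-arc) , refl , q) =
    (↔-sym φ , from-arc , to-arc) ,
    Inverse.strictlyInverseʳ φ _ ,
    trans (cong (Inverse.from φ) (sym q)) (Inverse.strictlyInverseʳ φ _)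

  ∼-trans : ∀ {x y z} → x ∼ y → y ∼ z → x ∼ z
  ∼-trans ((φ , to-arc , from-arc) , refl , q) ((ψ , to-arc′ , from-arc′) , refl , q′) =
    (ψ ↔-∘ φ , to-arc′ ∘ to-arc , from-arc ∘ from-arc′) , refl ,
    trans (cong (Inverse.to ψ) q) q′

  -- The level of an arc is immaterial: raising all levels by one is an automorphism.
  ∼-next : ∀ i {x d} → ((i , x) , d) ∼ ((next i , x) , d)
  ∼-next i = (mk↔ₛ′ (λ (i , x) → next i , x) (λ (i , x) → prev i , x)
      (λ (i , x) → cong (_, x) (next-prev i)) (λ (i , x) → cong (_, x) (prev-next i))
    , (λ (d , e) → d , cong (λ (i , x) → next i , x) e)
    , (λ { {v} (d , refl) → d , cong (_, push d (proj₂ v)) (trans (next-prev _) (sym (prev-next _))) }))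
    , refl , refl

  ∼-level : ∀ i j {x d} → ((i , x) , d) ∼ ((j , x) , d)
  ∼-level i j = ∼-trans (to-zero i) (∼-sym (to-zero j))
    where
    to-zero : ∀ i {x d} → ((i , x) , d) ∼ ((0F , x) , d)
    to-zero 0F = ∼-refl
    to-zero 1F = ∼-trans (∼-next 1F) (∼-trans (∼-next 2F) (∼-trans (∼-next 3F) (∼-next 4F)))
    to-zero 2F = ∼-trans (∼-next 2F) (∼-trans (∼-next 3F) (∼-next 4F))
    to-zero 3F = ∼-trans (∼-next 3F) (∼-next 4F)
    to-zero 4F = ∼-next 4F

  infix 4 _≈_
  _≈_ : State × Bool → State × Bool → Set
  (x , d) ≈ (y , e) = ((0F , x) , d) ∼ ((0F , y) , e)

  -- The maps `φ i`, one on each level, form a single automorphism, and `χ` records its effect on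
  -- appended bits. Since the level of an arc does not affect its orbit, an arc can be moved to any
  -- level `i`, mapped there and moved back, so each level of the family yields a relation of its
  -- own.
  ≈-family : (φ ψ : Fin 5 → State → State) (χ : Fin 5 → Bool → Bool) →
    (∀ i x → φ i (ψ i x) ≡ x) → (∀ i x → ψ i (φ i x) ≡ x) →
    (∀ i d x → push (χ i d) (φ i x) ≡ φ (next i) (push d x)) →
    (∀ i d x → push (χ i d) (ψ i x) ≡ ψ (next i) (push d x)) →
    ∀ i x d → (x , d) ≈ (φ i x , χ i d)
  ≈-family φ ψ χ φψ ψφ φ-push ψ-push i x d = ∼-trans (∼-level 0F i) (∼-trans
    ((mk↔ₛ′ (λ (i , x) → i , φ i x) (λ (i , x) → i , ψ i x)
       (λ (i , x) → cong (i ,_) (φψ i x)) (λ (i , x) → cong (i ,_) (ψφ i x))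
     , (λ { {i , x} (d , refl) → χ i d , cong (next i ,_) (φ-push i d x) })
     , (λ { {i , x} (d , refl) → χ i d , cong (next i ,_) (ψ-push i d x) }))
     , refl , cong (next i ,_) (sym (φ-push i d x)))
    (∼-level i 0F))

  Bits³ Bits⁴ : Set
  Bits³ = Bool × Bool × Bool
  Bits⁴ = Bool × Bits³

  Closed : Vertex → Bool → Bits⁴ → Set
  Closed v d₀ (d₁ , d₂ , d₃ , d₄) = up d₄ (up d₃ (up d₂ (up d₁ (up d₀ v)))) ≡ v

  UniquelyClosed DoublyClosed : Set
  UniquelyClosed = Σ (Vertex → Bits⁴) λ r →
    (∀ v d → Closed v d (r v)) × (∀ v d ds → Closed v d ds → ds ≡ r v)
  DoublyClosed = Σ (Vertex → Bits³) λ r →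
    (∀ v d d₁ → Closed v d (d₁ , r v)) × (∀ v d d₁ ds → Closed v d (d₁ , ds) → ds ≡ r v)

  HomogeneousAt ConnectedTo : State → Set
  HomogeneousAt x₀ = ∀ x d → (x , d) ≈ (x₀ , false)
  ConnectedTo x₀ = ∀ v → Linked v (0F , x₀)

-- The underlying graph: connectedness and valency.

module FromDigraph (D : LevelledDigraph) where
  open LevelledDigraph D

  enc : Vertex → Fin size
  enc = Inverse.to code

  dec : Fin size → Vertex
  dec = Inverse.from code

  enc-dec : ∀ p → enc (dec p) ≡ p
  enc-dec = Inverse.strictlyInverseˡ code

  dec-enc : ∀ v → dec (enc v) ≡ v
  dec-enc = Inverse.strictlyInverseʳ code

  enc-injective : ∀ {v w} → enc v ≡ enc w → v ≡ w
  enc-injective {v} {w} e = trans (sym (dec-enc v)) (trans (cong dec e) (dec-enc w))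

  dec-injective : ∀ {p q} → dec p ≡ dec q → p ≡ q
  dec-injective {p} {q} e = trans (sym (enc-dec p)) (trans (cong enc e) (enc-dec q))

  Arc? : ∀ v w → Dec (Arc v w)
  Arc? v w = map′ (λ e → gained w , enc-injective e) (cong enc ∘ gained-arc)
    (enc (up (gained w) v) ≟ enc w)

  arc : Fin size → Fin size → Bool
  arc p q = does (Arc? (dec p) (dec q))

  arc-complete : ∀ {p q} → Arc (dec p) (dec q) → arc p q ≡ true
  arc-complete = dec-true (Arc? _ _)

  arc-sound : ∀ p q → arc p q ≡ true → Arc (dec p) (dec q)
  arc-sound p q e = invert (subst (Reflects _) e (proof (Arc? (dec p) (dec q))))

  Arc-irrefl : ∀ {v} → ¬ Arc v v
  Arc-irrefl a = next≢id _ (sym (level-arc a))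

  Arc-asym : ∀ {v w} → Arc v w → ¬ Arc w v
  Arc-asym a b = next²≢id _ (sym (trans (level-arc b) (cong next (level-arc a))))

  graph : Graph
  graph = record
    { n      = size
    ; adj    = λ p q → arc p q ∨ arc q p
    ; irrefl = λ p → cong (λ b → b ∨ b) (dec-false (Arc? (dec p) (dec p)) Arc-irrefl)
    ; sym    = λ p q → ∨-comm (arc p q) (arc q p)
    }

  Adjacent : Fin size → Fin size → Set
  Adjacent = Adj graph

  Step : Fin 2 → Vertex → Vertex → Set
  Step 0F v w = Arc v w
  Step 1F v w = Arc w v

  step-adjacent : ∀ s {p q} → Step s (dec p) (dec q) → Adjacent p q
  step-adjacent 0F {p} {q} a rewrite arc-complete {p} {q} a = refl
  step-adjacent 1F {p} {q} a rewrite arc-complete {q} {p} a = ∨-zeroʳ (arc p q)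

  adjacent-step : ∀ p q → Adjacent p q → ∃ λ s → Step s (dec p) (dec q)
  adjacent-step p q a with arc p q in e | arc q p in e′
  ... | true  | _    = 0F , arc-sound p q e
  ... | false | true = 1F , arc-sound q p e′

  enc-adjacent : ∀ s {v w} → Step s v w → Adjacent (enc v) (enc w)
  enc-adjacent s {v} {w} a =
    step-adjacent s (subst₂ (Step s) (sym (dec-enc v)) (sym (dec-enc w)) a)

  level-step : ∀ s {v w} → Step s v w → level w ≡ shift s (level v)
  level-step 0F a = level-arc a
  level-step 1F a = trans (sym (prev-next _)) (cong prev (sym (level-arc a)))

  linked-reach : ∀ {v w} → Linked v w → Reach graph (enc v) (enc w)
  linked-reach ε           = here
  linked-reach (fwd a ◅ l) = step (enc-adjacent 0F a) (linked-reach l)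
  linked-reach (bwd a ◅ l) = step (enc-adjacent 1F a) (linked-reach l)

  connected : ∀ x₀ → ConnectedTo x₀ → Connected graph
  connected x₀ c p q = subst₂ (Reach graph) (enc-dec p) (enc-dec q)
    (linked-reach (c (dec p) ◅◅ symmetric Arc (c (dec q))))

  neighbour : Vertex → Fin 4 → Vertex
  neighbour v 0F = up false v
  neighbour v 1F = up true v
  neighbour v 2F = down false v
  neighbour v 3F = down true v

  up≢down : ∀ d e v → up d v ≢ down e v
  up≢down d e v eq = next≢prev (level v) (cong level eq)

  choice-injective : ∀ {d e v} → up d v ≡ up e v → d ≡ e
  choice-injective {d} {e} {v} eq =
    trans (sym (newest-push d (proj₂ v))) (trans (cong gained eq) (newest-push e (proj₂ v)))

  down-choice-injective : ∀ {d e v} → down d v ≡ down e v → d ≡ e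
  down-choice-injective {d} {e} {v} eq =
    trans (sym (oldest-pull d (proj₂ v))) (trans (cong lost eq) (oldest-pull e (proj₂ v)))

  neighbour-injective : ∀ v i j → neighbour v i ≡ neighbour v j → i ≡ j
  neighbour-injective v 0F 0F e = refl
  neighbour-injective v 0F 1F e = contradiction (choice-injective e) λ ()
  neighbour-injective v 0F 2F e = contradiction e (up≢down _ _ v)
  neighbour-injective v 0F 3F e = contradiction e (up≢down _ _ v)
  neighbour-injective v 1F 0F e = contradiction (choice-injective e) λ ()
  neighbour-injective v 1F 1F e = refl
  neighbour-injective v 1F 2F e = contradiction e (up≢down _ _ v)
  neighbour-injective v 1F 3F e = contradiction e (up≢down _ _ v)
  neighbour-injective v 2F 0F e = contradiction (sym e) (up≢down _ _ v)
  neighbour-injective v 2F 1F e = contradiction (sym e) (up≢down _ _ v)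
  neighbour-injective v 2F 2F e = refl
  neighbour-injective v 2F 3F e = contradiction (down-choice-injective e) λ ()
  neighbour-injective v 3F 0F e = contradiction (sym e) (up≢down _ _ v)
  neighbour-injective v 3F 1F e = contradiction (sym e) (up≢down _ _ v)
  neighbour-injective v 3F 2F e = contradiction (down-choice-injective e) λ ()
  neighbour-injective v 3F 3F e = refl

  neighbour-step : ∀ v i → ∃ λ s → Step s v (neighbour v i)
  neighbour-step v 0F = 0F , up-arc false v
  neighbour-step v 1F = 0F , up-arc true v
  neighbour-step v 2F = 1F , down-arc false v
  neighbour-step v 3F = 1F , down-arc true v

  step-neighbour : ∀ s {v w} → Step s v w → ∃ λ i → neighbour v i ≡ w
  step-neighbour 0F (false , e) = 0F , e
  step-neighbour 0F (true  , e) = 1F , e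
  step-neighbour 1F {v} {w} a with lost w | lost-arc a
  ... | false | e = 2F , e
  ... | true  | e = 3F , e

  tetravalent : Tetravalent graph
  tetravalent p = enc ∘ neighbour (dec p)
    , (λ i j e → neighbour-injective (dec p) i j (enc-injective e))
    , (λ i → let s , a = neighbour-step (dec p) i
             in step-adjacent s (subst (Step s (dec p)) (sym (dec-enc _)) a))
    , (λ q a → let s , b = adjacent-step p q a
                   i , e = step-neighbour s b
               in i , trans (cong enc e) (enc-dec q))

  -- Absence of 3-cycles and 4-cycles.

  -- As distinct out-neighbours of `v`, the vertices `x` and `y` have different newest bits. Hence
  -- both pushes agree on `v` and `w`, and `push-injective` applies.
  no-alternating-4-cycle : ∀ {v w x y} → Arc v x → Arc w x → Arc v y → Arc w y → x ≢ y → v ≡ w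
  no-alternating-4-cycle {v} {w} {x} {y} a b c d x≢y =
    join (gained x) (gained y) refl refl
    where
    common : ∀ {z} e → Arc v z → Arc w z → gained z ≡ e → up e v ≡ up e w
    common e p q refl = trans (gained-arc p) (sym (gained-arc q))

    merge : up false v ≡ up false w → up true v ≡ up true w → v ≡ w
    merge p q = cong₂ _,_
      (trans (sym (prev-next _)) (trans (cong (prev ∘ level) p) (prev-next _)))
      (push-injective _ _ (cong proj₂ p) (cong proj₂ q))

    join : ∀ e f → gained x ≡ e → gained y ≡ f → v ≡ w
    join false true  p q = merge (common false a b p) (common true c d q)
    join true  false p q = merge (common false c d q) (common true a b p)
    join false false p q = contradiction
      (trans (sym (gained-arc a)) (trans (cong (λ e → up e v) (trans p (sym q))) (gained-arc c))) x≢y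
    join true  true  p q = contradiction
      (trans (sym (gained-arc a)) (trans (cong (λ e → up e v) (trans p (sym q))) (gained-arc c))) x≢y

  -- Both paths append the newest bit of `w` last, so they can differ only in the bit before, which
  -- `push²-injective` recovers.
  two-path-unique : ∀ {v w x y} → Arc v x → Arc x w → Arc v y → Arc y w → x ≡ y
  two-path-unique {v} (d , refl) b (d′ , refl) c =
    cong (λ e → up e v) (push²-injective d d′ _ (proj₂ v)
      (cong proj₂ (trans (gained-arc b) (sym (gained-arc c)))))

  no-triangle : ¬ HasCycle graph 3
  no-triangle (f , _ , edge , last) =
    let r , a = adjacent-step (f 0F) (f 1F) (edge 0F)
        s , b = adjacent-step (f 1F) (f 2F) (edge 1F)
        t , c = adjacent-step (f 2F) (f 0F) last
    in shift³≢id r s t _ (sym (trans (level-step t c)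
         (cong (shift t) (trans (level-step s b) (cong (shift s) (level-step r a))))))

  no-4-cycle : ¬ HasCycle graph 4
  no-4-cycle (f , inj , edge , last) =
    let r , a = adjacent-step (f 0F) (f 1F) (edge 0F)
        s , b = adjacent-step (f 1F) (f 2F) (edge 1F)
        t , c = adjacent-step (f 2F) (f 3F) (edge 2F)
        u , d = adjacent-step (f 3F) (f 0F) last
    in exclude r s t u a b c d (shift⁴-balanced r s t u _ (sym (trans (level-step u d)
         (cong (shift u) (trans (level-step t c) (cong (shift t)
           (trans (level-step s b) (cong (shift s) (level-step r a)))))))))
    where
    F : Fin 4 → Vertex
    F = dec ∘ f

    0≢2 : F 0F ≢ F 2F
    0≢2 e = contradiction (inj 0F 2F (dec-injective e)) λ ()

    1≢3 : F 1F ≢ F 3F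
    1≢3 e = contradiction (inj 1F 3F (dec-injective e)) λ ()

    exclude : ∀ r s t u → Step r (F 0F) (F 1F) → Step s (F 1F) (F 2F) →
      Step t (F 2F) (F 3F) → Step u (F 3F) (F 0F) → ¬ (toℕ r + toℕ s + toℕ t + toℕ u ≡ 2)
    -- Of the six balanced patterns, two alternate and four consist of two directed paths joining
    -- opposite corners; the others contradict the sum.
    exclude 0F 1F 0F 1F a b c d refl = 0≢2 (no-alternating-4-cycle a b d c 1≢3)
    exclude 1F 0F 1F 0F a b c d refl = 1≢3 (no-alternating-4-cycle a d b c 0≢2)
    exclude 0F 0F 1F 1F a b c d refl = 1≢3 (two-path-unique a b d c)
    exclude 1F 1F 0F 0F a b c d refl = 1≢3 (two-path-unique b a c d)
    exclude 0F 1F 1F 0F a b c d refl = 0≢2 (two-path-unique d a c b)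
    exclude 1F 0F 0F 1F a b c d refl = 0≢2 (two-path-unique a d b c)
    exclude 0F 0F 0F 0F _ _ _ _ ()
    exclude 0F 0F 0F 1F _ _ _ _ ()
    exclude 0F 0F 1F 0F _ _ _ _ ()
    exclude 0F 1F 0F 0F _ _ _ _ ()
    exclude 0F 1F 1F 1F _ _ _ _ ()
    exclude 1F 0F 0F 0F _ _ _ _ ()
    exclude 1F 0F 1F 1F _ _ _ _ ()
    exclude 1F 1F 0F 1F _ _ _ _ ()
    exclude 1F 1F 1F 0F _ _ _ _ ()
    exclude 1F 1F 1F 1F _ _ _ _ ()

  no-short-cycle : ∀ ℓ → 3 ≤ ℓ → ℓ < 5 → ¬ HasCycle graph ℓ
  no-short-cycle 1 (s≤s ()) _
  no-short-cycle 2 (s≤s (s≤s ())) _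
  no-short-cycle 3 _ _ = no-triangle
  no-short-cycle 4 _ _ = no-4-cycle
  no-short-cycle (suc (suc (suc (suc (suc _))))) _ (s≤s (s≤s (s≤s (s≤s (s≤s ())))))

  -- Cycles of length 5 as directed closed walks.

  trace : Vertex → Bool → Bool → Bool → Bool → Fin 5 → Vertex
  trace v d₀ d₁ d₂ d₃ 0F = v
  trace v d₀ d₁ d₂ d₃ 1F = up d₀ v
  trace v d₀ d₁ d₂ d₃ 2F = up d₁ (up d₀ v)
  trace v d₀ d₁ d₂ d₃ 3F = up d₂ (up d₁ (up d₀ v))
  trace v d₀ d₁ d₂ d₃ 4F = up d₃ (up d₂ (up d₁ (up d₀ v)))

  level-trace : ∀ v d₀ d₁ d₂ d₃ i → level (trace v d₀ d₁ d₂ d₃ i) ≡ offset i (level v)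
  level-trace v d₀ d₁ d₂ d₃ 0F = refl
  level-trace v d₀ d₁ d₂ d₃ 1F = refl
  level-trace v d₀ d₁ d₂ d₃ 2F = refl
  level-trace v d₀ d₁ d₂ d₃ 3F = refl
  level-trace v d₀ d₁ d₂ d₃ 4F = refl

  -- The five vertices lie on five different levels, hence are distinct.
  trace-cycle : ∀ v d₀ d₁ d₂ d₃ d₄ → Closed v d₀ (d₁ , d₂ , d₃ , d₄) →
    IsCycle graph 4 (enc ∘ trace v d₀ d₁ d₂ d₃)
  trace-cycle v d₀ d₁ d₂ d₃ d₄ closed =
      (λ i j e → offset-injective (level v) i j
        (trans (sym (level-trace v d₀ d₁ d₂ d₃ i))
          (trans (cong level (enc-injective e)) (level-trace v d₀ d₁ d₂ d₃ j))))
    , (λ { 0F → enc-adjacent 0F (up-arc _ _)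
         ; 1F → enc-adjacent 0F (up-arc _ _)
         ; 2F → enc-adjacent 0F (up-arc _ _)
         ; 3F → enc-adjacent 0F (up-arc _ _) })
    , enc-adjacent 0F (d₄ , closed)

  trace-through : ∀ {p q} d₀ d₁ d₂ d₃ d₄ → up d₀ (dec p) ≡ dec q →
    Closed (dec p) d₀ (d₁ , d₂ , d₃ , d₄) →
    FiveCycleThrough graph p q (enc ∘ trace (dec p) d₀ d₁ d₂ d₃)
  trace-through {p} {q} d₀ d₁ d₂ d₃ d₄ e closed =
    trace-cycle (dec p) d₀ d₁ d₂ d₃ d₄ closed , enc-dec p , trans (cong enc e) (enc-dec q)

  -- Levels add up to ±5 along a 5-cycle, so it is traversed consistently.
  through-trace : ∀ {p q h} d₀ → up d₀ (dec p) ≡ dec q → FiveCycleThrough graph p q h →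
    ∃ λ d₁ → ∃ λ d₂ → ∃ λ d₃ → ∃ λ d₄ → Closed (dec p) d₀ (d₁ , d₂ , d₃ , d₄)
      × (∀ i → h i ≡ enc (trace (dec p) d₀ d₁ d₂ d₃ i))
  through-trace {h = h} d₀ e ((inj , edge , last) , refl , refl) =
    let s , b = adjacent-step (h 1F) (h 2F) (edge 1F)
        t , c = adjacent-step (h 2F) (h 3F) (edge 2F)
        u , d = adjacent-step (h 3F) (h 4F) (edge 3F)
        w , z = adjacent-step (h 4F) (h 0F) last
        dirs  = shift⁵-constant 0F s t u w _ (sym (trans (level-step w z)
          (cong (shift w) (trans (level-step u d) (cong (shift u) (trans (level-step t c)
            (cong (shift t) (trans (level-step s b) (cong (shift s) (level-arc (d₀ , e)))))))))))
    in follow s t u w b c d z dirs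
    where
    H : Fin 5 → Vertex
    H = dec ∘ h

    follow : ∀ s t u w → Step s (H 1F) (H 2F) → Step t (H 2F) (H 3F) →
      Step u (H 3F) (H 4F) → Step w (H 4F) (H 0F) → 0F ≡ s × s ≡ t × t ≡ u × u ≡ w →
      ∃ λ d₁ → ∃ λ d₂ → ∃ λ d₃ → ∃ λ d₄ → Closed (H 0F) d₀ (d₁ , d₂ , d₃ , d₄)
        × (∀ i → h i ≡ enc (trace (H 0F) d₀ d₁ d₂ d₃ i))
    follow s t u w (d₁ , e₁) (d₂ , e₂) (d₃ , e₃) (d₄ , e₄) (refl , refl , refl , refl) =
      d₁ , d₂ , d₃ , d₄ , trans (cong (up d₄) q₄) e₄ ,
      λ { 0F → sym (enc-dec _)
        ; 1F → back e
        ; 2F → back q₂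
        ; 3F → back q₃
        ; 4F → back q₄ }
      where
      back : ∀ {v i} → v ≡ H i → h i ≡ enc v
      back q = trans (sym (enc-dec _)) (cong enc (sym q))

      q₂ : up d₁ (up d₀ (H 0F)) ≡ H 2F
      q₂ = trans (cong (up d₁) e) e₁

      q₃ : up d₂ (up d₁ (up d₀ (H 0F))) ≡ H 3F
      q₃ = trans (cong (up d₂) q₂) e₂

      q₄ : up d₃ (up d₂ (up d₁ (up d₀ (H 0F)))) ≡ H 4F
      q₄ = trans (cong (up d₃) q₃) e₃

  girth-5 : ∀ v d ds → Closed v d ds → Girth graph 5
  girth-5 v d (d₁ , d₂ , d₃ , d₄) closed =
    (_ , trace-cycle v d d₁ d₂ d₃ d₄ closed) , no-short-cycle

  -- The reflection `i ↦ 1 - i` modulo 5. It reverses a 5-cycle along an edge, which reduces an edge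
  -- listed against its arc to one listed along it.
  swap₀₁ : Fin 5 → Fin 5
  swap₀₁ 0F = 1F
  swap₀₁ 1F = 0F
  swap₀₁ 2F = 4F
  swap₀₁ 3F = 3F
  swap₀₁ 4F = 2F

  swap₀₁-involutive : ∀ i → swap₀₁ (swap₀₁ i) ≡ i
  swap₀₁-involutive = from-yes (all? λ i → swap₀₁ (swap₀₁ i) ≟ i)

  reverse-through : ∀ {p q f} → FiveCycleThrough graph p q f →
    FiveCycleThrough graph q p (f ∘ swap₀₁)
  reverse-through {f = f} ((inj , edge , last) , e₀ , e₁) =
    ( (λ i j e → trans (sym (swap₀₁-involutive i))
                   (trans (cong swap₀₁ (inj _ _ e)) (swap₀₁-involutive j)))
    , (λ { 0F → flipped (f 0F) (f 1F) (edge 0F)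
         ; 1F → flipped (f 4F) (f 0F) last
         ; 2F → flipped (f 3F) (f 4F) (edge 3F)
         ; 3F → flipped (f 2F) (f 3F) (edge 2F) })
    , flipped (f 1F) (f 2F) (edge 1F)) , e₁ , e₀
    where
    flipped : ∀ p q → Adjacent p q → Adjacent q p
    flipped p q a = trans (Graph.sym graph q p) a

  unswap : ∀ {f g : Fin 5 → Fin size} → (∀ i → f (swap₀₁ i) ≡ g i) → ∀ i → f i ≡ g (swap₀₁ i)
  unswap {f} e i = trans (cong f (sym (swap₀₁-involutive i))) (e (swap₀₁ i))

  unique-5-cycle : UniquelyClosed → EachEdgeOnUnique5Cycle graph
  unique-5-cycle (r , closed , only) p q a = let s , b = adjacent-step p q a in oriented s b
    where
    along : ∀ {p q} → Arc (dec p) (dec q) → Σ (Fin 5 → Fin size) λ f →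
      FiveCycleThrough graph p q f × (∀ h → FiveCycleThrough graph p q h → ∀ i → h i ≡ f i)
    along {p} (d , e) = _ , trace-through d _ _ _ _ e (closed (dec p) d) , λ h through i →
      let d₁ , d₂ , d₃ , d₄ , c , eq = through-trace d e through
      in trans (eq i) (cong (λ (x , y , z , _) → enc (trace (dec p) d x y z i)) (only _ _ _ c))

    oriented : ∀ s → Step s (dec p) (dec q) → Σ (Fin 5 → Fin size) λ f →
      FiveCycleThrough graph p q f × (∀ h → FiveCycleThrough graph p q h → ∀ i → h i ≡ f i)
    oriented 0F b = along b
    oriented 1F b = let f , through , unique = along b in
      f ∘ swap₀₁ , reverse-through through ,
      λ h t → unswap (unique (h ∘ swap₀₁) (reverse-through t))

  two-5-cycles : DoublyClosed → EachEdgeOnExactlyTwo5Cycles graph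
  two-5-cycles (r , closed , only) p q a = let s , b = adjacent-step p q a in oriented s b
    where
    Two : Fin size → Fin size → Set
    Two p q = Σ (Fin 5 → Fin size) λ f → Σ (Fin 5 → Fin size) λ g →
        FiveCycleThrough graph p q f × FiveCycleThrough graph p q g × ¬ (∀ i → f i ≡ g i)
      × (∀ h → FiveCycleThrough graph p q h → (∀ i → h i ≡ f i) ⊎ (∀ i → h i ≡ g i))

    along : ∀ {p q} → Arc (dec p) (dec q) → Two p q
    along {p} (d , e) = _ , _
      , trace-through d false _ _ _ e (closed (dec p) d false)
      , trace-through d true  _ _ _ e (closed (dec p) d true)
      -- The two walks append different second bits, so they part at position 2.
      , (λ same → contradiction (choice-injective (enc-injective (same 2F))) λ ())
      , λ h through →
        let d₁ , d₂ , d₃ , d₄ , c , eq = through-trace d e through in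
        pick (λ d₁ → enc ∘ trace (dec p) d d₁ _ _) d₁ λ i → trans (eq i)
          (cong (λ (y , z , _) → enc (trace (dec p) d d₁ y z i)) (only _ _ _ _ c))
      where
      pick : ∀ {h : Fin 5 → Fin size} (g : Bool → Fin 5 → Fin size) d₁ → (∀ i → h i ≡ g d₁ i) →
        (∀ i → h i ≡ g false i) ⊎ (∀ i → h i ≡ g true i)
      pick g false = inj₁
      pick g true  = inj₂

    oriented : ∀ s → Step s (dec p) (dec q) → Two p q
    oriented 0F b = along b
    oriented 1F b = let f , g , tf , tg , f≢g , exhaust = along b in
      f ∘ swap₀₁ , g ∘ swap₀₁ , reverse-through tf , reverse-through tg ,
      (λ same → f≢g λ i → trans (unswap same i) (cong g (swap₀₁-involutive i))) ,
      λ h t → Sum.map unswap unswap (exhaust (h ∘ swap₀₁) (reverse-through t))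

  -- The half-arc-transitive group.

  ArcPreserving : Permutation′ size → Set
  ArcPreserving σ = ∀ p q → arc (σ ⟨$⟩ʳ p) (σ ⟨$⟩ʳ q) ≡ arc p q

  realise : Automorphism → Permutation′ size
  realise (φ , _) = code ↔-∘ (φ ↔-∘ ↔-sym code)

  realise-preserves : ∀ φ → ArcPreserving (realise φ)
  realise-preserves (φ , to-arc , from-arc) p q = does-⇔
    (mk⇔ (λ a → subst₂ Arc (undo p) (undo q) (from-arc a))
         (λ a → subst₂ Arc (sym (dec-enc _)) (sym (dec-enc _)) (to-arc a)))
    (Arc? _ _) (Arc? _ _)
    where
    undo : ∀ p → Inverse.from φ (dec (enc (Inverse.to φ (dec p)))) ≡ dec p
    undo p = trans (cong (Inverse.from φ) (dec-enc _)) (Inverse.strictlyInverseʳ φ _)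

  ∼-realise : ∀ {p q x y} (a : Arc (dec p) (dec q)) (b : Arc (dec x) (dec y)) →
    (dec p , proj₁ a) ∼ (dec x , proj₁ b) →
    Σ (Permutation′ size) λ σ → ArcPreserving σ × σ ⟨$⟩ʳ p ≡ x × σ ⟨$⟩ʳ q ≡ y
  ∼-realise {x = x} {y} (d , e) (d′ , e′) (φ , m , m′) =
    realise φ , realise-preserves φ , trans (cong enc m) (enc-dec x) ,
    trans (cong (enc ∘ Inverse.to (proj₁ φ)) (sym e))
      (trans (cong enc (trans m′ e′)) (enc-dec y))

  -- Homogeneity puts all arcs of the digraph in one orbit. Every vertex is the tail of an arc and
  -- every edge carries exactly one, whence both transitivities.
  admits-HAT : ∀ x₀ → HomogeneousAt x₀ → AdmitsHATGroup graph
  admits-HAT x₀ homogeneous =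
    ArcPreserving , subgroup , vertex-transitive , edge-transitive , not-arc-transitive
    where
    all∼ : ∀ {x y} → x ∼ y
    all∼ {(i , x) , d} {(j , y) , e} = ∼-trans (∼-level i 0F) (∼-trans (homogeneous x d)
      (∼-trans (∼-sym (homogeneous y e)) (∼-level 0F j)))

    subgroup : IsSubgroupOfAut graph ArcPreserving
    subgroup = (λ σ g p q → cong₂ _∨_ (g p q) (g q p))
      , (λ p q → refl)
      , (λ σ τ g h p q → trans (h _ _) (g p q))
      , (λ σ g p q → trans (sym (g _ _)) (cong₂ arc (inverseʳ σ) (inverseʳ σ)))

    vertex-transitive : VertexTransitive graph ArcPreserving
    vertex-transitive p q =
      let φ , m , _ = all∼ {dec p , false} {dec q , false}
      in realise φ , realise-preserves φ , trans (cong enc m) (enc-dec q)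

    edge-transitive : EdgeTransitive graph ArcPreserving
    edge-transitive p q x y a b =
      let s , c = adjacent-step p q a
          t , d = adjacent-step x y b
      in oriented s t c d
      where
      oriented : ∀ s t → Step s (dec p) (dec q) → Step t (dec x) (dec y) →
        Σ (Permutation′ size) λ σ → ArcPreserving σ ×
          ((σ ⟨$⟩ʳ p ≡ x × σ ⟨$⟩ʳ q ≡ y) ⊎ (σ ⟨$⟩ʳ p ≡ y × σ ⟨$⟩ʳ q ≡ x))
      oriented 0F 0F c d = let σ , g , m , m′ = ∼-realise c d all∼ in σ , g , inj₁ (m , m′)
      oriented 0F 1F c d = let σ , g , m , m′ = ∼-realise c d all∼ in σ , g , inj₂ (m , m′)
      oriented 1F 0F c d = let σ , g , m , m′ = ∼-realise c d all∼ in σ , g , inj₂ (m′ , m)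
      oriented 1F 1F c d = let σ , g , m , m′ = ∼-realise c d all∼ in σ , g , inj₁ (m′ , m)

    not-arc-transitive : ¬ ArcTransitive graph ArcPreserving
    not-arc-transitive transitive =
      let v₀ = 0F , x₀
          p = enc v₀
          q = enc (up false v₀)
          -- A permutation reversing this edge would produce an arc opposite to an existing one.
          σ , g , m , m′ = transitive p q q p 
            (enc-adjacent 0F (up-arc false v₀)) (enc-adjacent 1F (up-arc false v₀))
          pq = subst₂ Arc (sym (dec-enc _)) (sym (dec-enc _)) (up-arc false v₀)
      in Arc-asym pq (arc-sound q p (trans (sym (cong₂ arc m m′)) (trans (g p q) (arc-complete pq))))

infixr 2 _⊗_
_⊗_ : ∀ {A B : Set} {m n} → A ↔ Fin m → B ↔ Fin n → (A × B) ↔ Fin (m * n)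
f ⊗ g = ↔-sym *↔× ↔-∘ (f ×-↔ g)

-- Arithmetic of a cyclic counter.

module Rotation (n : ℕ) where

  C : Set
  C = Fin (2+ n)

  -- The rotations of the (n+2)-gon as products of two of its reflections.
  reflect : C → C
  reflect zero    = zero
  reflect (suc c) = suc (opposite c)

  rise fall : C → C
  rise = reflect ∘ opposite
  fall = opposite ∘ reflect

  reflect-involutive : ∀ c → reflect (reflect c) ≡ c
  reflect-involutive zero    = refl
  reflect-involutive (suc c) = cong suc (opposite-involutive c)

  rise-fall : ∀ c → rise (fall c) ≡ c
  rise-fall c = trans (cong reflect (opposite-involutive (reflect c))) (reflect-involutive c)

  fall-rise : ∀ c → fall (rise c) ≡ c
  fall-rise c = trans (cong opposite (reflect-involutive (opposite c))) (opposite-involutive c)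

  -- Modulo `n + 2`, `opposite` is `c ↦ - 1 - c`, and a reflection conjugates a rotation to its
  -- inverse; this lets `opposite` serve as negation up to a translation.
  opposite-fall : ∀ c → opposite (fall c) ≡ rise (opposite c)
  opposite-fall c = trans (opposite-involutive (reflect c)) (cong reflect (sym (opposite-involutive c)))

  fall-suc : ∀ c → fall (suc c) ≡ inject₁ c
  fall-suc c = cong inject₁ (opposite-involutive c)

  -- Zero goes to `n + 1`, which is nonzero because the modulus is at least 2. A single increment is
  -- therefore always visible in a counter.
  fall≢id : ∀ c → fall c ≢ c
  fall≢id zero    ()
  fall≢id (suc c) e = ℕ.1+n≢n (sym (trans (sym (toℕ-inject₁ c))
    (trans (cong toℕ (sym (fall-suc c))) (cong toℕ e))))

  rise≢id : ∀ c → rise c ≢ c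
  rise≢id c e = fall≢id c (trans (cong fall (sym e)) (fall-rise c))

  descend : (P : C → Set) → P zero → (∀ c → P (fall c) → P c) → ∀ c → P c
  descend P base ascend = <-weakInduction P base λ c p → ascend (suc c) (subst P (sym (fall-suc c)) p)

  add sub : Bool → C → C
  add false c = c
  add true  c = rise c
  sub false c = c
  sub true  c = fall c

  sub-add : ∀ b c → sub b (add b c) ≡ c
  sub-add false c = refl
  sub-add true  c = fall-rise c

  add-sub : ∀ b c → add b (sub b c) ≡ c
  add-sub false c = refl
  add-sub true  c = rise-fall c

  add-injectiveˡ : ∀ a b c → add a c ≡ add b c → a ≡ b
  add-injectiveˡ false false c e = refl
  add-injectiveˡ false true  c e = contradiction (sym e) (rise≢id c)
  add-injectiveˡ true  false c e = contradiction e (rise≢id c)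
  add-injectiveˡ true  true  c e = refl

  sub-injectiveʳ : ∀ b {c c′} → sub b c ≡ sub b c′ → c ≡ c′
  sub-injectiveʳ b {c} {c′} e = trans (sym (add-sub b c)) (trans (cong (add b) e) (add-sub b c′))

  fall-add : ∀ b c → add b (fall c) ≡ fall (add b c)
  fall-add false c = refl
  fall-add true  c = trans (rise-fall c) (sym (fall-rise c))

  fall-sub : ∀ b c → sub b (fall c) ≡ fall (sub b c)
  fall-sub false c = refl
  fall-sub true  c = refl

  rise-add : ∀ b c → add b (rise c) ≡ rise (add b c)
  rise-add false c = refl
  rise-add true  c = refl

  rise-sub : ∀ b c → sub b (rise c) ≡ rise (sub b c)
  rise-sub false c = refl
  rise-sub true  c = trans (fall-rise c) (sym (rise-fall c))

  -- With opposite read as negation, these are the bit identities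
  -- (1 - d) a - a = - d a  and  d (1 - a) = d - d a  and their negatives.
  negate-add : ∀ d a c → add (not d ∧ a) (sub a (opposite c)) ≡ opposite (add (d ∧ a) c)
  negate-add false a     c = add-sub a (opposite c)
  negate-add true  false c = refl
  negate-add true  true  c = refl

  negate-sub : ∀ b d c → sub (b ∧ not d) (add b (opposite c)) ≡ opposite (sub (b ∧ d) c)
  negate-sub false d     c = refl
  negate-sub true  false c = fall-rise (opposite c)
  negate-sub true  true  c = sym (opposite-fall c)

  complement-sub : ∀ b d c → sub (not b ∧ d) (opposite c) ≡ sub d (opposite (sub (b ∧ d) c))
  complement-sub false d     c = refl
  complement-sub true  false c = refl
  complement-sub true  true  c = trans (sym (fall-rise (opposite c))) (cong fall (sym (opposite-fall c)))

  complement-add : ∀ d a c → add (d ∧ not a) (opposite c) ≡ add d (opposite (add (d ∧ a) c))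
  complement-add false a     c = refl
  complement-add true  false c = refl
  complement-add true  true  c = sym (rise-fall (opposite c))

  -- The map `c ↦ sub b (opposite c)` is again a reflection. With the next lemma this makes the
  -- corrected bit flips involutions.
  negate-sub-involutive : ∀ b c → sub b (opposite (sub b (opposite c))) ≡ c
  negate-sub-involutive false c = opposite-involutive c
  negate-sub-involutive true  c = trans (cong fall (opposite-fall (opposite c)))
    (trans (fall-rise _) (opposite-involutive c))

  negate-add-involutive : ∀ b c → add b (opposite (add b (opposite c))) ≡ c
  negate-add-involutive false c = opposite-involutive c
  negate-add-involutive true  c = trans (rise-fall (opposite (opposite c))) (opposite-involutive c)

-- Shift registers with counters.

record BitRegister : Set₁ where
  field
    Bits             : Set
    bitStates        : ℕ
    -- The successor makes the number of words positive, so that the order of the graph grows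
    -- strictly with the modulus.
    bitCode          : Bits ↔ Fin (suc bitStates)
    shiftIn shiftOut : Bool → Bits → Bits
    first last       : Bits → Bool
    product          : Bits → Bool
    last-shiftIn     : ∀ d β → last (shiftIn d β) ≡ d
    first-shiftOut   : ∀ d β → first (shiftOut d β) ≡ d
    out-in           : ∀ d β → shiftOut (first β) (shiftIn d β) ≡ β
    in-out           : ∀ d β → shiftIn (last β) (shiftOut d β) ≡ β
    in²-injective    : ∀ d d′ e β → shiftIn e (shiftIn d β) ≡ shiftIn e (shiftIn d′ β) → d ≡ d′

module Counters (R : BitRegister) (n : ℕ) where
  open BitRegister R
  open Rotation n public

  Counters : Set
  Counters = C × C × C × C × C

  ,-cong⁵ : ∀ {β β′ : Bits} {v₀ v₁ v₂ v₃ v₄ w₀ w₁ w₂ w₃ w₄ : C} → β ≡ β′ →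
    v₀ ≡ w₀ → v₁ ≡ w₁ → v₂ ≡ w₂ → v₃ ≡ w₃ → v₄ ≡ w₄ →
    _≡_ {A = Bits × Counters} (β , v₀ , v₁ , v₂ , v₃ , v₄) (β′ , w₀ , w₁ , w₂ , w₃ , w₄)
  ,-cong⁵ refl refl refl refl refl refl = refl

  -- Counters are listed relative to the level: `w₀` is the one increased by the present push, and
  -- it is decreased in the second push after that, when it stands in the place of `w₃`.
  pushed pulled : Bool → Bits × Counters → Bits × Counters
  pushed d (β , w₀ , w₁ , w₂ , w₃ , w₄) =
    shiftIn d β , w₁ , w₂ , sub (product (shiftIn d β)) w₃ , w₄ , add (d ∧ first β) w₀
  pulled a (β , w₀ , w₁ , w₂ , w₃ , w₄) =
    shiftOut a β , sub (last β ∧ a) w₄ , w₀ , w₁ , add (product β) w₂ , w₃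

  -- Pushing `false` leaves the value of `w₀` intact and loses only the first bit of the word;
  -- pushing `true` adds that bit to `w₀`, which reveals it.
  pushed-injective : ∀ x y → pushed false x ≡ pushed false y → pushed true x ≡ pushed true y → x ≡ y
  pushed-injective (β , w₀ , w₁ , w₂ , w₃ , w₄) (β′ , w₀′ , w₁′ , w₂′ , w₃′ , w₄′) p q =
    ,-cong⁵
      (trans (sym (out-in false β)) (trans (cong₂ shiftOut same-first same-shift) (out-in false β′)))
      same-w₀ (cong (proj₁ ∘ proj₂) p) (cong (proj₁ ∘ proj₂ ∘ proj₂) p)
      (sub-injectiveʳ (product (shiftIn false β)) (trans (cong (proj₁ ∘ proj₂ ∘ proj₂ ∘ proj₂) p)
        (cong (λ γ → sub (product γ) w₃′) (sym same-shift))))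
      (cong (proj₁ ∘ proj₂ ∘ proj₂ ∘ proj₂ ∘ proj₂) p)
    where
    same-shift : shiftIn false β ≡ shiftIn false β′
    same-shift = cong proj₁ p

    same-w₀ : w₀ ≡ w₀′
    same-w₀ = cong (proj₂ ∘ proj₂ ∘ proj₂ ∘ proj₂ ∘ proj₂) p

    same-first : first β ≡ first β′
    same-first = add-injectiveˡ _ _ w₀
      (trans (cong (proj₂ ∘ proj₂ ∘ proj₂ ∘ proj₂ ∘ proj₂) q) (cong (add (first β′)) (sym same-w₀)))

  digraph : LevelledDigraph
  digraph = record
    { State           = Bits × Counters
    ; stateCode       = bitCode ⊗ ↔-id C ⊗ ↔-id C ⊗ ↔-id C ⊗ ↔-id C ⊗ ↔-id C
    ; push            = pushed
    ; pull            = pulled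
    ; newest          = last ∘ proj₁
    ; oldest          = first ∘ proj₁
    ; newest-push     = λ d x → last-shiftIn d (proj₁ x)
    ; oldest-pull     = λ d x → first-shiftOut d (proj₁ x)
    ; pull-push       = λ d (β , w₀ , w₁ , w₂ , w₃ , w₄) → ,-cong⁵ (out-in d β)
        (trans (cong (λ e → sub (e ∧ first β) _) (last-shiftIn d β)) (sub-add (d ∧ first β) w₀))
        refl refl (add-sub (product (shiftIn d β)) w₃) refl
    ; push-pull       = λ d (β , w₀ , w₁ , w₂ , w₃ , w₄) → ,-cong⁵ (in-out d β)
        refl refl
        (trans (cong (λ γ → sub (product γ) _) (in-out d β)) (sub-add (product β) w₂)) refl
        (trans (cong (λ e → add (last β ∧ e) _) (first-shiftOut d β)) (add-sub (last β ∧ d) w₄))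
    ; push-injective  = pushed-injective
    ; push²-injective = λ d d′ e x p → in²-injective d d′ e (proj₁ x) (cong proj₁ p)
    }

  open LevelledDigraph digraph public
  open FromDigraph digraph public

  -- One counter in absolute position; relative positions rotate with the level.
  onCounter : (C → C) → Fin 5 → State → State
  onCounter κ 0F (β , w₀ , w₁ , w₂ , w₃ , w₄) = β , κ w₀ , w₁ , w₂ , w₃ , w₄
  onCounter κ 1F (β , w₀ , w₁ , w₂ , w₃ , w₄) = β , w₀ , w₁ , w₂ , w₃ , κ w₄
  onCounter κ 2F (β , w₀ , w₁ , w₂ , w₃ , w₄) = β , w₀ , w₁ , w₂ , κ w₃ , w₄
  onCounter κ 3F (β , w₀ , w₁ , w₂ , w₃ , w₄) = β , w₀ , w₁ , κ w₂ , w₃ , w₄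
  onCounter κ 4F (β , w₀ , w₁ , w₂ , w₃ , w₄) = β , w₀ , κ w₁ , w₂ , w₃ , w₄

  onCounter-inverse : ∀ {κ μ : C → C} → (∀ c → κ (μ c) ≡ c) →
    ∀ i x → onCounter κ i (onCounter μ i x) ≡ x
  onCounter-inverse e 0F x = ,-cong⁵ refl (e _) refl refl refl refl
  onCounter-inverse e 1F x = ,-cong⁵ refl refl refl refl refl (e _)
  onCounter-inverse e 2F x = ,-cong⁵ refl refl refl refl (e _) refl
  onCounter-inverse e 3F x = ,-cong⁵ refl refl refl (e _) refl refl
  onCounter-inverse e 4F x = ,-cong⁵ refl refl (e _) refl refl refl

  -- A push changes only the counters in places 0 and 3. The chosen one stands there at levels 0 and
  -- 2, and is merely moved at the others.
  onCounter-push : ∀ {κ : C → C} → (∀ b c → add b (κ c) ≡ κ (add b c)) →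
    (∀ b c → sub b (κ c) ≡ κ (sub b c)) →
    ∀ i d x → push d (onCounter κ i x) ≡ onCounter κ (next i) (push d x)
  onCounter-push κ-add κ-sub 0F d (β , w₀ , _) =
    ,-cong⁵ refl refl refl refl refl (κ-add (d ∧ first β) w₀)
  onCounter-push κ-add κ-sub 1F d x = refl
  onCounter-push κ-add κ-sub 2F d (β , w₀ , w₁ , w₂ , w₃ , _) =
    ,-cong⁵ refl refl refl (κ-sub (product (shiftIn d β)) w₃) refl refl
  onCounter-push κ-add κ-sub 3F d x = refl
  onCounter-push κ-add κ-sub 4F d x = refl

  ≈-fall : ∀ i x d → (x , d) ≈ (onCounter fall i x , d)
  ≈-fall = ≈-family (onCounter fall) (onCounter rise) (λ _ d → d)
    (onCounter-inverse fall-rise) (onCounter-inverse rise-fall)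
    (onCounter-push fall-add fall-sub) (onCounter-push rise-add rise-sub)

  zeros : Counters
  zeros = zero , zero , zero , zero , zero

  ≈-reset : ∀ β w d → ((β , w) , d) ≈ ((β , zeros) , d)
  ≈-reset β (w₀ , w₁ , w₂ , w₃ , w₄) d =
    -- At level `i` the translated counter stands in place `- i` modulo 5, hence the levels 0, 4, 3,
    -- 2, 1 for the places 0 to 4.
    ∼-trans (reset (λ c → β , c , w₁ , w₂ , w₃ , w₄) (λ c → ≈-fall 0F _ d) w₀)
    (∼-trans (reset (λ c → β , zero , c , w₂ , w₃ , w₄) (λ c → ≈-fall 4F _ d) w₁)
    (∼-trans (reset (λ c → β , zero , zero , c , w₃ , w₄) (λ c → ≈-fall 3F _ d) w₂)
    (∼-trans (reset (λ c → β , zero , zero , zero , c , w₄) (λ c → ≈-fall 2F _ d) w₃)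
    (reset (λ c → β , zero , zero , zero , zero , c) (λ c → ≈-fall 1F _ d) w₄))))
    where
    reset : (f : C → State) → (∀ c → (f c , d) ≈ (f (fall c) , d)) →
      ∀ c → (f c , d) ≈ (f zero , d)
    reset f fall-≈ = descend (λ c → (f c , d) ≈ (f zero , d)) ∼-refl (λ c → ∼-trans (fall-≈ c))

  -- Once the word is `β₀`, the front counter is lowered to zero and rotated to the back; five
  -- rounds clear all counters.
  module Connect (β₀ : Bits)
    (flush : ∀ i β w → ∃ λ j → ∃ λ w′ → Linked (i , β , w) (j , β₀ , w′))
    (rotate : ∀ i w₀ w₁ w₂ w₃ w₄ →
      Linked (i , β₀ , w₀ , w₁ , w₂ , w₃ , w₄) (next i , β₀ , w₁ , w₂ , w₃ , w₄ , w₀))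
    (lower : ∀ i w₀ w₁ w₂ w₃ w₄ →
      Linked (i , β₀ , w₀ , w₁ , w₂ , w₃ , w₄) (i , β₀ , fall w₀ , w₁ , w₂ , w₃ , w₄))
    where

    reset : ∀ i w₀ w₁ w₂ w₃ w₄ →
      Linked (i , β₀ , w₀ , w₁ , w₂ , w₃ , w₄) (next i , β₀ , w₁ , w₂ , w₃ , w₄ , zero)
    reset i w₀ w₁ w₂ w₃ w₄ = descend
      (λ c → Linked (i , β₀ , c , w₁ , w₂ , w₃ , w₄) (i , β₀ , zero , w₁ , w₂ , w₃ , w₄)) ε
      (λ c → lower i c w₁ w₂ w₃ w₄ ◅◅_) w₀ ◅◅ rotate i zero w₁ w₂ w₃ w₄

    to-level-0 : ∀ i → Linked (i , β₀ , zeros) (0F , β₀ , zeros)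
    to-level-0 0F = ε
    to-level-0 1F = turn 1F ◅◅ turn 2F ◅◅ turn 3F ◅◅ turn 4F
      where turn = λ i → rotate i zero zero zero zero zero
    to-level-0 2F = turn 2F ◅◅ turn 3F ◅◅ turn 4F
      where turn = λ i → rotate i zero zero zero zero zero
    to-level-0 3F = turn 3F ◅◅ turn 4F
      where turn = λ i → rotate i zero zero zero zero zero
    to-level-0 4F = rotate 4F zero zero zero zero zero

    connectedTo : ConnectedTo (β₀ , zeros)
    connectedTo (i , β , w) =
      let j , (w₀ , w₁ , w₂ , w₃ , w₄) , l = flush i β w
      in l ◅◅ reset _ w₀ _ _ _ _ ◅◅ reset _ w₁ _ _ _ _ ◅◅ reset _ w₂ _ _ _ _
           ◅◅ reset _ w₃ _ _ _ _ ◅◅ reset _ w₄ _ _ _ _ ◅◅ to-level-0 _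


bool : Bool ↔ Fin 2
bool = ↔-sym 2↔Bool

next⁵ : ∀ i → next (next (next (next (next i)))) ≡ i
next⁵ = from-yes (all? λ i → next (next (next (next (next i)))) ≟ i)

flipChoice : Fin 5 → Bool → Bool
flipChoice 0F d = not d
flipChoice _  d = d

-- Words of four bits: one 5-cycle on each edge.

module FourBits where

  register : BitRegister
  register = record
    { Bits           = Bool × Bool × Bool × Bool
    ; bitCode        = bool ⊗ bool ⊗ bool ⊗ bool
    ; shiftIn        = λ e (a , b , c , d) → b , c , d , e
    ; shiftOut       = λ z (a , b , c , d) → z , a , b , c
    ; first          = λ (a , b , c , d) → a
    ; last           = λ (a , b , c , d) → d
    -- The push of bit s(t) adds s(t)·s(t-4). Two pushes later s(t) and s(t+1) are the third last
    -- and second last bits, and s(t+1) = s(t-4) on a sequence of period 5.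
    ; product        = λ (a , b , c , d) → b ∧ c
    ; last-shiftIn   = λ _ _ → refl
    ; first-shiftOut = λ _ _ → refl
    ; out-in         = λ _ _ → refl
    ; in-out         = λ _ _ → refl
    ; in²-injective  = λ d d′ e β p → cong (λ (_ , _ , c , _) → c) p
    }

  β₀ : Bool × Bool × Bool × Bool
  β₀ = false , false , false , false

  module _ (n : ℕ) where
    open Counters register n

    -- After five pushes the word consists of the last four bits appended, so these must be the
    -- initial word.
    uniquelyClosed : UniquelyClosed
    uniquelyClosed = (λ (_ , β , _) → β)
      , (λ { (i , (d₁ , d₂ , d₃ , d₄) , w₀ , w₁ , w₂ , w₃ , w₄) d → cong₂ _,_ (next⁵ i)
             (,-cong⁵ refl (sub-add (d ∧ d₁) w₀) (sub-add (d₁ ∧ d₂) w₁) (sub-add (d₂ ∧ d₃) w₂)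
               (add-sub (d₃ ∧ d₄) w₃) (add-sub (d₄ ∧ d) w₄)) })
      , (λ _ _ _ p → cong (proj₁ ∘ proj₂) p)

    -- The level of a vertex tells where the flipped bit currently sits, if anywhere.
    flip : Fin 5 → State → State
    flip 0F ((a , b , c , d) , w₀ , w₁ , w₂ , w₃ , w₄) =
      (a , b , c , d) , sub a (opposite w₀) , w₁ , w₂ , w₃ , add d (opposite w₄)
    flip 1F ((a , b , c , d) , w₀ , w₁ , w₂ , w₃ , w₄) =
      (a , b , c , not d) , w₀ , w₁ , w₂ , add c (opposite w₃) , opposite w₄
    flip 2F ((a , b , c , d) , w₀ , w₁ , w₂ , w₃ , w₄) =
      (a , b , not c , d) , w₀ , w₁ , opposite w₂ , opposite w₃ , w₄
    flip 3F ((a , b , c , d) , w₀ , w₁ , w₂ , w₃ , w₄) =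
      (a , not b , c , d) , w₀ , opposite w₁ , sub c (opposite w₂) , w₃ , w₄
    flip 4F ((a , b , c , d) , w₀ , w₁ , w₂ , w₃ , w₄) =
      (not a , b , c , d) , opposite w₀ , sub b (opposite w₁) , w₂ , w₃ , w₄

    flip-involutive : ∀ i x → flip i (flip i x) ≡ x
    flip-involutive 0F ((a , b , c , d) , _) =
      ,-cong⁵ refl (negate-sub-involutive a _) refl refl refl (negate-add-involutive d _)
    flip-involutive 1F ((a , b , c , d) , _) =
      ,-cong⁵ (cong (λ z → a , b , c , z) (not-involutive d))
        refl refl refl (negate-add-involutive c _) (opposite-involutive _)
    flip-involutive 2F ((a , b , c , d) , _) =
      ,-cong⁵ (cong (λ z → a , b , z , d) (not-involutive c))
        refl refl (opposite-involutive _) (opposite-involutive _) refl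
    flip-involutive 3F ((a , b , c , d) , _) =
      ,-cong⁵ (cong (λ z → a , z , c , d) (not-involutive b))
        refl (opposite-involutive _) (negate-sub-involutive c _) refl refl
    flip-involutive 4F ((a , b , c , d) , _) =
      ,-cong⁵ (cong (λ z → z , b , c , d) (not-involutive a))
        (opposite-involutive _) (negate-sub-involutive b _) refl refl refl

    -- The flipped bits enter only the counters increased on leaving levels 0 and 4. For the latter
    -- `complement-add` opens a correction at the increase and `negate-sub` closes it at the
    -- decrease; for the former `complement-sub` opens it at the decrease and `negate-add` closes it
    -- at the increase.
    flip-push : ∀ i e x → push (flipChoice i e) (flip i x) ≡ flip (next i) (push e x)
    flip-push 0F e ((a , b , c , d) , w₀ , _) = ,-cong⁵ refl refl refl refl refl (negate-add e a w₀)
    flip-push 1F e ((a , b , c , d) , _ , _ , _ , w₃ , _) =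
      ,-cong⁵ refl refl refl (negate-sub c d w₃) refl refl
    flip-push 2F e ((a , b , c , d) , _ , _ , _ , w₃ , _) =
      ,-cong⁵ refl refl refl (complement-sub c d w₃) refl refl
    flip-push 3F e x = refl
    flip-push 4F e ((a , b , c , d) , w₀ , _) =
      ,-cong⁵ refl refl refl refl refl (complement-add e a w₀)

    ≈-flip : ∀ i x e → (x , e) ≈ (flip i x , flipChoice i e)
    ≈-flip = ≈-family flip flip flipChoice flip-involutive flip-involutive flip-push flip-push

    -- The level selects which bit a flip changes: the choice at level 0, then the word from newest
    -- to oldest. Changes made to the counters on the way are undone at the end by `≈-reset`.
    homogeneous : HomogeneousAt (β₀ , zeros)
    homogeneous = clear-choice
      where
      clear-a : ∀ a w → (((a , false , false , false) , w) , false) ≈ ((β₀ , zeros) , false)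
      clear-a false w = ≈-reset β₀ w false
      clear-a true  w = ∼-trans (≈-flip 4F _ false) (≈-reset β₀ _ false)

      clear-b : ∀ a b w → (((a , b , false , false) , w) , false) ≈ ((β₀ , zeros) , false)
      clear-b a false w = clear-a a w
      clear-b a true  w = ∼-trans (≈-flip 3F _ false) (clear-a a _)

      clear-c : ∀ a b c w → (((a , b , c , false) , w) , false) ≈ ((β₀ , zeros) , false)
      clear-c a b false w = clear-b a b w
      clear-c a b true  w = ∼-trans (≈-flip 2F _ false) (clear-b a b _)

      clear-d : ∀ a b c d w → (((a , b , c , d) , w) , false) ≈ ((β₀ , zeros) , false)
      clear-d a b c false w = clear-c a b c w
      clear-d a b c true  w = ∼-trans (≈-flip 1F _ false) (clear-c a b c _)

      clear-choice : HomogeneousAt (β₀ , zeros)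
      clear-choice ((a , b , c , d) , w) false = clear-d a b c d w
      clear-choice ((a , b , c , d) , w) true  = ∼-trans (≈-flip 0F _ true) (clear-d a b c d _)

    connectedTo : ConnectedTo (β₀ , zeros)
    connectedTo = Connect.connectedTo β₀
      (λ i β w → _ , _ , fwd (up-arc false _) ◅ fwd (up-arc false _) ◅ fwd (up-arc false _)
        ◅ fwd (up-arc false _) ◅ ε)
      (λ i w₀ w₁ w₂ w₃ w₄ → fwd (false , refl) ◅ ε)
      (λ i w₀ w₁ w₂ w₃ w₄ →
        -- This runs round an alternating 4-cycle of words. Only its arc appending 1 to 1000 changes
        -- the counter, so the walk ends one lower.
        fwd (true , refl)
        ◅ bwd {b = i , (true , false , false , false) , fall w₀ , w₁ , w₂ , w₃ , w₄}
              (true , cong (λ c → next i , _ , w₁ , w₂ , w₃ , w₄ , c) (rise-fall w₀))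
        ◅ fwd (false , refl) ◅ bwd (false , refl) ◅ ε)

-- Words of three bits: two 5-cycles on each edge.

module ThreeBits where

  register : BitRegister
  register = record
    { Bits           = Bool × Bool × Bool
    ; bitCode        = bool ⊗ bool ⊗ bool
    ; shiftIn        = λ d (a , b , c) → b , c , d
    ; shiftOut       = λ z (a , b , c) → z , a , b
    ; first          = λ (a , b , c) → a
    ; last           = λ (a , b , c) → c
    -- Here the amount added is s(t)·s(t-3); the word two pushes later begins with s(t) and ends
    -- with s(t+2), which is s(t-3) for period 5.
    ; product        = λ (a , b , c) → a ∧ c
    ; last-shiftIn   = λ _ _ → refl
    ; first-shiftOut = λ _ _ → refl
    ; out-in         = λ _ _ → refl
    ; in-out         = λ _ _ → refl
    ; in²-injective  = λ d d′ e β p → cong (λ (_ , b , _) → b) p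
    }

  β₀ : Bool × Bool × Bool
  β₀ = false , false , false

  module _ (n : ℕ) where
    open Counters register n

    -- The first two bits appended leave the register again, so `d₁` is free, while the last three
    -- must be the initial word.
    doublyClosed : DoublyClosed
    doublyClosed = (λ (_ , β , _) → β)
      , (λ { (i , (d₂ , d₃ , d₄) , w₀ , w₁ , w₂ , w₃ , w₄) d d₁ → cong₂ _,_ (next⁵ i)
             (,-cong⁵ refl (sub-add (d ∧ d₂) w₀) (sub-add (d₁ ∧ d₃) w₁) (sub-add (d₂ ∧ d₄) w₂)
               (add-sub (d₃ ∧ d) w₃) (add-sub (d₄ ∧ d₁) w₄)) })
      , (λ _ _ _ _ p → cong (proj₁ ∘ proj₂) p)

    -- The flipped bit is in the word at levels 1 to 3 only. It enters the counters increased on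
    -- leaving levels 0 and 3.
    flip : Fin 5 → State → State
    flip 0F ((a , b , c) , w₀ , w₁ , w₂ , w₃ , w₄) =
      (a , b , c) , sub a (opposite w₀) , w₁ , w₂ , add b (opposite w₃) , w₄
    flip 1F ((a , b , c) , w₀ , w₁ , w₂ , w₃ , w₄) =
      (a , b , not c) , w₀ , w₁ , opposite w₂ , w₃ , opposite w₄
    flip 2F ((a , b , c) , w₀ , w₁ , w₂ , w₃ , w₄) =
      (a , not b , c) , w₀ , opposite w₁ , w₂ , opposite w₃ , w₄
    flip 3F ((a , b , c) , w₀ , w₁ , w₂ , w₃ , w₄) =
      (not a , b , c) , opposite w₀ , w₁ , sub c (opposite w₂) , w₃ , w₄
    flip 4F ((a , b , c) , w₀ , w₁ , w₂ , w₃ , w₄) =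
      (a , b , c) , w₀ , sub b (opposite w₁) , w₂ , w₃ , add c (opposite w₄)

    flip-involutive : ∀ i x → flip i (flip i x) ≡ x
    flip-involutive 0F ((a , b , c) , _) =
      ,-cong⁵ refl (negate-sub-involutive a _) refl refl (negate-add-involutive b _) refl
    flip-involutive 1F ((a , b , c) , _) =
      ,-cong⁵ (cong (λ z → a , b , z) (not-involutive c))
        refl refl (opposite-involutive _) refl (opposite-involutive _)
    flip-involutive 2F ((a , b , c) , _) =
      ,-cong⁵ (cong (λ z → a , z , c) (not-involutive b))
        refl (opposite-involutive _) refl (opposite-involutive _) refl
    flip-involutive 3F ((a , b , c) , _) =
      ,-cong⁵ (cong (λ z → z , b , c) (not-involutive a))
        (opposite-involutive _) refl (negate-sub-involutive c _) refl refl
    flip-involutive 4F ((a , b , c) , _) =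
      ,-cong⁵ refl refl (negate-sub-involutive b _) refl refl (negate-add-involutive c _)

    flip-push : ∀ i d x → push (flipChoice i d) (flip i x) ≡ flip (next i) (push d x)
    flip-push 0F d ((a , b , c) , w₀ , _ , _ , w₃ , _) =
      ,-cong⁵ refl refl refl (negate-sub b d w₃) refl (negate-add d a w₀)
    flip-push 1F d x = refl
    flip-push 2F d ((a , b , c) , _ , _ , _ , w₃ , _) =
      ,-cong⁵ refl refl refl (complement-sub b d w₃) refl refl
    flip-push 3F d ((a , b , c) , w₀ , _) =
      ,-cong⁵ refl refl refl refl refl (complement-add d a w₀)
    flip-push 4F d x = refl

    ≈-flip : ∀ i x d → (x , d) ≈ (flip i x , flipChoice i d)
    ≈-flip = ≈-family flip flip flipChoice flip-involutive flip-involutive flip-push flip-push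

    homogeneous : HomogeneousAt (β₀ , zeros)
    homogeneous = clear-choice
      where
      clear-a : ∀ a w → (((a , false , false) , w) , false) ≈ ((β₀ , zeros) , false)
      clear-a false w = ≈-reset β₀ w false
      clear-a true  w = ∼-trans (≈-flip 3F _ false) (≈-reset β₀ _ false)

      clear-b : ∀ a b w → (((a , b , false) , w) , false) ≈ ((β₀ , zeros) , false)
      clear-b a false w = clear-a a w
      clear-b a true  w = ∼-trans (≈-flip 2F _ false) (clear-a a _)

      clear-c : ∀ a b c w → (((a , b , c) , w) , false) ≈ ((β₀ , zeros) , false)
      clear-c a b false w = clear-b a b w
      clear-c a b true  w = ∼-trans (≈-flip 1F _ false) (clear-b a b _)

      clear-choice : HomogeneousAt (β₀ , zeros)
      clear-choice ((a , b , c) , w) false = clear-c a b c w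
      clear-choice ((a , b , c) , w) true  = ∼-trans (≈-flip 0F _ true) (clear-c a b c _)

    connectedTo : ConnectedTo (β₀ , zeros)
    connectedTo = Connect.connectedTo β₀
      (λ i β w → _ , _ , fwd (up-arc false _) ◅ fwd (up-arc false _) ◅ fwd (up-arc false _) ◅ ε)
      (λ i w₀ w₁ w₂ w₃ w₄ → fwd (false , refl) ◅ ε)
      (λ i w₀ w₁ w₂ w₃ w₄ →
        fwd (true , refl)
        ◅ bwd {b = i , (true , false , false) , fall w₀ , w₁ , w₂ , w₃ , w₄}
              (true , cong (λ c → next i , _ , w₁ , w₂ , w₃ , w₄ , c) (rise-fall w₀))
        ◅ fwd (false , refl) ◅ bwd (false , refl) ◅ ε)

-- Infinitely many graphs, told apart by their orders.

module _ (R : BitRegister) where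
  open BitRegister R

  Γ : ℕ → Graph
  Γ n = Counters.graph R n

  power : ℕ → ℕ
  power m = m * (m * (m * (m * m)))

  power-mono-< : ∀ {m k} → m < k → power m < power k
  power-mono-< p = ℕ.*-mono-< p (ℕ.*-mono-< p (ℕ.*-mono-< p (ℕ.*-mono-< p p)))

  size-mono-< : ∀ {m k} → m < k → Graph.n (Γ m) < Graph.n (Γ k)
  size-mono-< p = ℕ.*-monoʳ-< 5 (ℕ.*-monoʳ-< (suc bitStates) (power-mono-< (s≤s (s≤s p))))

  -- The order is 5 times the number of words times the fifth power of the modulus, hence strictly
  -- increasing.
  pairwise-non-isomorphic : ∀ i j → i ≢ j → ¬ Isomorphic (Γ i) (Γ j)
  pairwise-non-isomorphic i j i≢j (φ , _) with ℕ.<-cmp i j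
  ... | tri< i<j _ _ = ℕ.<⇒≢ (size-mono-< i<j) (↔⇒≡ φ)
  ... | tri≈ _ i≡j _ = i≢j i≡j
  ... | tri> _ _ j<i = ℕ.<⇒≢ (size-mono-< j<i) (sym (↔⇒≡ φ))

theorem6p7 : InfinitelyManyNonIso (λ Γ → Connected Γ × Tetravalent Γ × Girth Γ 5
    × AdmitsHATGroup Γ × EachEdgeOnUnique5Cycle Γ)
    × InfinitelyManyNonIso (λ Γ → Connected Γ × Tetravalent Γ × Girth Γ 5
    × AdmitsHATGroup Γ × EachEdgeOnExactlyTwo5Cycles Γ)
theorem6p7 =
    ( Γ FourBits.register , pairwise-non-isomorphic FourBits.register , λ n →
      let open Counters FourBits.register n
          (_ , closed , _) = FourBits.uniquelyClosed n
          x₀ = FourBits.β₀ , zeros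
      in connected x₀ (FourBits.connectedTo n) , tetravalent ,
         girth-5 (0F , x₀) false FourBits.β₀ (closed (0F , x₀) false)
       , admits-HAT x₀ (FourBits.homogeneous n) , unique-5-cycle (FourBits.uniquelyClosed n) )
  , ( Γ ThreeBits.register , pairwise-non-isomorphic ThreeBits.register , λ n →
      let open Counters ThreeBits.register n
          (_ , closed , _) = ThreeBits.doublyClosed n
          x₀ = ThreeBits.β₀ , zeros
      in connected x₀ (ThreeBits.connectedTo n) , tetravalent ,
         girth-5 (0F , x₀) false (false , ThreeBits.β₀) (closed (0F , x₀) false false)
       , admits-HAT x₀ (ThreeBits.homogeneous n) , two-5-cycles (ThreeBits.doublyClosed n) )
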